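{- If $\mathbf{x}$ is a (one-sided, right-) infinite word over $\{0,1\}$ that is mesosome-free, then $\mathbf{x}$ or its binary complement $\overline{\mathbf{x}}$ has one of the following forms, for some integers $i, j \geq 1$: - $0^{\omega}$; - $0^{i}\,1^{\omega}$; - $0^{i}\,1^{2j-1}\,0^{\omega}$; - $0^{i}10\,1^{\omega}$; - $(01)^{\omega}$.
   Context: Two finite words $x, x'$ are conjugates if there exist (possibly empty) words $u, v$ with $x = uv$ and $x' = vu$. A finite nonempty word $w$ is a mesosome if it is of the form $w = xx'$ where $x'$ is a conjugate of $x$ and $x \neq x'$. A factor of a word is a finite contiguous sub-block of it. A finite or infinite word is mesosome-free if none of its factors is a mesosome. For a finite nonempty word $x$, $x^{\omega}$ denotes the infinite word $xxx\cdots$. The binary complement of a word over $\{0,1\}$ is obtained by replacing each $0$ by $1$ and each $1$ by $0$. -}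

module Defs where

open import Data.Bool using (Bool; true; false; not)
open import Data.List using (List; []; _∷_; _++_; applyUpTo; length; lookup; replicate)
open import Data.List.NonEmpty using (List⁺; _∷_; [_])
open import Data.Nat using (ℕ; zero; suc; _+_; _*_; _∸_; _≤_)
open import Data.Nat.DivMod using (_mod_)
open import Data.Product using (∃₂; _×_)
open import Function using (_∘_)
open import Relation.Binary.PropositionalEquality using (_≡_; _≢_; _≗_)
open import Relation.Nullary using (¬_)

private
  variable
    A : Set

Word : Set → Set
Word A = List A

-- Right-infinite words; equality of infinite words is pointwise, i.e. _≗_.
ωWord : Set → Set
ωWord A = ℕ → A

Conjugates : Word A → Word A → Set
Conjugates x x′ = ∃₂ λ u v → x ≡ u ++ v × x′ ≡ v ++ u

Mesosome : Word A → Set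
Mesosome w = w ≢ [] × ∃₂ λ x x′ → w ≡ x ++ x′ × Conjugates x x′ × x ≢ x′

-- applyUpTo f n is the list f 0 ∷ … ∷ f (n ∸ 1) ∷ [].
_FactorOf_ : Word A → ωWord A → Set
w FactorOf x = ∃₂ λ i n → w ≡ applyUpTo (λ k → x (i + k)) n

MesosomeFree : ωWord A → Set
MesosomeFree x = ∀ w → w FactorOf x → ¬ Mesosome w

infixr 5 _++ω_
infix 8 _^ω

_++ω_ : Word A → ωWord A → ωWord A
([]       ++ω y) n       = y n
((a ∷ _)  ++ω y) zero    = a
((_ ∷ as) ++ω y) (suc n) = (as ++ω y) n

_^ω : List⁺ A → ωWord A
((a ∷ as) ^ω) n = lookup (a ∷ as) (n mod suc (length as))

Bit : Set
Bit = Bool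

pattern 𝟎 = false
pattern 𝟏 = true

complement : ωWord Bit → ωWord Bit
complement x = not ∘ x

-- replicate i a is the power aⁱ.
data HasForm (x : ωWord Bit) : Set where
  0^ω : x ≗ [ 𝟎 ] ^ω → HasForm x

  0^i·1^ω : ∀ i → 1 ≤ i →
    x ≗ replicate i 𝟎 ++ω [ 𝟏 ] ^ω → HasForm x

  0^i·1^[2j-1]·0^ω : ∀ i j → 1 ≤ i → 1 ≤ j →
    x ≗ replicate i 𝟎 ++ω replicate (2 * j ∸ 1) 𝟏 ++ω [ 𝟎 ] ^ω → HasForm x

  0^i·10·1^ω : ∀ i → 1 ≤ i →
    x ≗ replicate i 𝟎 ++ω (𝟏 ∷ 𝟎 ∷ []) ++ω [ 𝟏 ] ^ω → HasForm x

  [01]^ω : x ≗ (𝟎 ∷ 𝟏 ∷ []) ^ω → HasForm x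

{-# OPTIONS --safe #-}

-- Inner runs have odd length, because b a²ᵐ b = (b aᵐ)(aᵐ b).  For odd q = 2m + 1 ≥ 3 the words
-- b^s a^q b^s a = (b^s a · aᵐ)(aᵐ · b^s a) and a b^s a^q b^s = (a b^s · aᵐ)(aᵐ · a b^s) are mesosomes,
-- so of the two runs around an inner run of length ≥ 3 the first is initial and the second is
-- infinite.  If all inner runs have length 1, then bbabab and bababb being mesosomes leaves at most
-- two of them, unless the word alternates forever.

module Submission where

open import Axiom.ExcludedMiddle using (ExcludedMiddle)
open import Data.Bool using (not)
open import Data.Bool.Properties using (_≟_; ¬-not; not-¬; not-involutive; not-injective)
open import Data.Empty using (⊥-elim)
open import Data.Fin using (zero)
open import Data.List using (List; []; _∷_; _++_; applyUpTo; concat; foldr; length; map; replicate)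
open import Data.List.NonEmpty using (_∷_; [_])
open import Data.List.Properties using (++-assoc; ++-identityʳ; ++-conicalˡ; ++-conicalʳ; map-++; map-injective; map-applyUpTo; ∷-injectiveˡ; ∷-injectiveʳ)
open import Data.Nat using (zero; suc; _+_; _*_; _∸_; _≤_; _<_; z≤n; s≤s; _≤′_; ≤′-refl; ≤′-step)
open import Data.Nat.DivMod using (_mod_)
open import Data.Nat.Properties using (_≤?_; ≤⇒≤′; +-suc; +-identityʳ; <⇒≤)
open import Data.Product using (∃; ∃₂; _×_; _,_)
open import Data.Sum using (_⊎_; inj₁; inj₂)
open import Function using (_∘_)
open import Level using (0ℓ)
open import Relation.Binary.PropositionalEquality using (_≡_; _≢_; _≗_; refl; sym; trans; cong; subst; module ≡-Reasoning)
open import Relation.Nullary using (¬_; yes; no)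
open import Defs

private
  variable
    A : Set
    a b : A
    x y : ωWord A

-- Finite prefixes of infinite words.

applyUpTo-cong : x ≗ y → ∀ n → applyUpTo x n ≡ applyUpTo y n
applyUpTo-cong x≗y zero = refl
applyUpTo-cong x≗y (suc n) rewrite x≗y 0 = cong (_ ∷_) (applyUpTo-cong (x≗y ∘ suc) n)

replicate-+ : ∀ m n (a : A) → replicate (m + n) a ≡ replicate m a ++ replicate n a
replicate-+ zero n a = refl
replicate-+ (suc m) n a = cong (a ∷_) (replicate-+ m n a)

++ω-cong : ∀ (u : Word A) → x ≗ y → u ++ω x ≗ u ++ω y
++ω-cong [] x≗y n = x≗y n
++ω-cong (a ∷ u) x≗y zero = refl
++ω-cong (a ∷ u) x≗y (suc n) = ++ω-cong u x≗y n

++ω-assoc : ∀ (u v : Word A) (y : ωWord A) → (u ++ v) ++ω y ≗ u ++ω v ++ω y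
++ω-assoc [] v y n = refl
++ω-assoc (a ∷ u) v y zero = refl
++ω-assoc (a ∷ u) v y (suc n) = ++ω-assoc u v y n

concat-++ω : ∀ (us : List (Word A)) (y : ωWord A) → foldr _++ω_ y us ≗ concat us ++ω y
concat-++ω [] y n = refl
concat-++ω (u ∷ us) y n =
  trans (++ω-cong u (concat-++ω us y) n) (sym (++ω-assoc u (concat us) y n))

applyUpTo-++ω : ∀ (w : Word A) (y : ωWord A) → w ≡ applyUpTo (w ++ω y) (length w)
applyUpTo-++ω [] y = refl
applyUpTo-++ω (a ∷ w) y = cong (a ∷_) (applyUpTo-++ω w y)

^ω-const : ∀ (a : A) n → ([ a ] ^ω) n ≡ a
^ω-const a n with n mod 1
... | zero = refl

[ab]^ω-suc : ∀ (a b : A) n → ((a ∷ b ∷ []) ^ω) (suc n) ≡ ((b ∷ a ∷ []) ^ω) n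
[ab]^ω-suc a b zero = refl
[ab]^ω-suc a b (suc zero) = refl
[ab]^ω-suc a b (suc (suc n)) = [ab]^ω-suc a b n

-- Stability of mesosome-freeness.

MesosomeFree-resp-≗ : x ≗ y → MesosomeFree x → MesosomeFree y
MesosomeFree-resp-≗ x≗y free w (i , n , w≡) =
  free w (i , n , trans w≡ (sym (applyUpTo-cong (λ k → x≗y (i + k)) n)))

MesosomeFree-suc : ∀ (x : ωWord A) → MesosomeFree x → MesosomeFree (x ∘ suc)
MesosomeFree-suc x free w (i , factor) = free w (suc i , factor)

MesosomeFree-++ω⁻ : ∀ (u : Word A) (y : ωWord A) → MesosomeFree (u ++ω y) → MesosomeFree y
MesosomeFree-++ω⁻ [] y free = free
MesosomeFree-++ω⁻ (a ∷ u) y free = MesosomeFree-++ω⁻ u y (MesosomeFree-suc ((a ∷ u) ++ω y) free)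

-- Removing leading letters leaves a suffix. This trims the first of several runs to whatever length
-- a forbidden factor asks for.
MesosomeFree-shorten : ∀ {m n} → m ≤ n →
  MesosomeFree (replicate n b ++ω y) → MesosomeFree (replicate m b ++ω y)
MesosomeFree-shorten {b = b} {y = y} = go ∘ ≤⇒≤′
  where
  go : ∀ {m n} → m ≤′ n →
    MesosomeFree (replicate n b ++ω y) → MesosomeFree (replicate m b ++ω y)
  go ≤′-refl free = free
  go (≤′-step {n} m≤n) free = go m≤n (MesosomeFree-suc (replicate (suc n) b ++ω y) free)

Mesosome-map : ∀ (f : A → A) → (∀ {a b} → f a ≡ f b → a ≡ b) →
  ∀ {w} → Mesosome w → Mesosome (map f w)
Mesosome-map f inj {[]} (w≢[] , _) = ⊥-elim (w≢[] refl)
Mesosome-map f inj {_ ∷ _} (_ , x , x′ , w≡ , (u , v , x≡ , x′≡) , x≢x′) =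
  (λ ()) , map f x , map f x′ , trans (cong (map f) w≡) (map-++ f x x′) ,
  (map f u , map f v ,
   trans (cong (map f) x≡) (map-++ f u v) , trans (cong (map f) x′≡) (map-++ f v u)) ,
  x≢x′ ∘ map-injective inj

MesosomeFree-complement : ∀ x → MesosomeFree x → MesosomeFree (complement x)
MesosomeFree-complement x free w (i , n , w≡) meso =
  free (map not w) (i , n , not-w≡) (Mesosome-map not not-injective meso)
  where
  open ≡-Reasoning
  not-w≡ : map not w ≡ applyUpTo (λ k → x (i + k)) n
  not-w≡ = begin
    map not w                                        ≡⟨ cong (map not) w≡ ⟩
    map not (applyUpTo (λ k → not (x (i + k))) n)    ≡⟨ map-applyUpTo _ not n ⟩
    applyUpTo (λ k → not (not (x (i + k)))) n        ≡⟨ applyUpTo-cong (λ k → not-involutive (x (i + k))) n ⟩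
    applyUpTo (λ k → x (i + k)) n                    ∎

-- Forbidden factors.

conjugates-mesosome : ∀ (u v : Word A) → u ++ v ≢ v ++ u → Mesosome ((u ++ v) ++ (v ++ u))
conjugates-mesosome u v uv≢vu =
  (λ e → uv≢vu (trans (++-conicalˡ (u ++ v) _ e) (sym (++-conicalʳ (u ++ v) _ e)))) ,
  u ++ v , v ++ u , refl , (u , v , refl , refl) , uv≢vu

no-conjugate-halves : ∀ (us : List (Word A)) (u v : Word A) →
  concat us ≡ (u ++ v) ++ (v ++ u) → u ++ v ≢ v ++ u →
  ¬ MesosomeFree (foldr _++ω_ y us)
no-conjugate-halves {y = y} us u v us≡ uv≢vu free =
  MesosomeFree-resp-≗ (concat-++ω us y) free (concat us)
    (0 , length (concat us) , applyUpTo-++ω (concat us) y)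
    (subst Mesosome (sym us≡) (conjugates-mesosome u v uv≢vu))

module _ {a b : A} (a≢b : a ≢ b) where
  open ≡-Reasoning

  ¬ba²ᵐb : ∀ m → ¬ MesosomeFree ((b ∷ []) ++ω replicate (suc m + suc m) a ++ω (b ∷ []) ++ω y)
  ¬ba²ᵐb m = no-conjugate-halves
    ((b ∷ []) ∷ replicate (suc m + suc m) a ∷ (b ∷ []) ∷ []) (b ∷ []) aᵐ
    (cong (b ∷_) (trans (cong (_++ (b ∷ [])) (replicate-+ (suc m) (suc m) a)) (++-assoc aᵐ aᵐ (b ∷ []))))
    (a≢b ∘ sym ∘ ∷-injectiveˡ)
    where aᵐ = replicate (suc m) a

  ¬bˢa^qbˢa : ∀ s m → ¬ MesosomeFree
    (replicate (suc s) b ++ω replicate (suc (suc m + suc m)) a ++ω replicate (suc s) b ++ω (a ∷ []) ++ω y)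
  ¬bˢa^qbˢa s m = no-conjugate-halves
    (bˢ ∷ (a ∷ replicate (suc m + suc m) a) ∷ bˢ ∷ (a ∷ []) ∷ []) (bˢ ++ a ∷ []) aᵐ eq
    (a≢b ∘ sym ∘ ∷-injectiveˡ)
    where
    bˢ = replicate (suc s) b
    aᵐ = replicate (suc m) a
    eq : bˢ ++ (a ∷ replicate (suc m + suc m) a) ++ bˢ ++ (a ∷ []) ≡ ((bˢ ++ a ∷ []) ++ aᵐ) ++ aᵐ ++ bˢ ++ a ∷ []
    eq = begin
      bˢ ++ a ∷ replicate (suc m + suc m) a ++ bˢ ++ a ∷ []
        ≡⟨ cong (λ w → bˢ ++ a ∷ w ++ bˢ ++ a ∷ []) (replicate-+ (suc m) (suc m) a) ⟩
      bˢ ++ a ∷ (aᵐ ++ aᵐ) ++ bˢ ++ a ∷ []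
        ≡⟨ cong (λ w → bˢ ++ a ∷ w) (++-assoc aᵐ aᵐ _) ⟩
      bˢ ++ a ∷ aᵐ ++ aᵐ ++ bˢ ++ a ∷ []
        ≡⟨ ++-assoc bˢ (a ∷ aᵐ) _ ⟨
      (bˢ ++ a ∷ aᵐ) ++ aᵐ ++ bˢ ++ a ∷ []
        ≡⟨ cong (_++ aᵐ ++ bˢ ++ a ∷ []) (++-assoc bˢ (a ∷ []) aᵐ) ⟨
      ((bˢ ++ a ∷ []) ++ aᵐ) ++ aᵐ ++ bˢ ++ a ∷ [] ∎

  ¬abˢa^qbˢ : ∀ s m → ¬ MesosomeFree
    ((a ∷ []) ++ω replicate (suc s) b ++ω replicate (suc (suc m + suc m)) a ++ω replicate (suc s) b ++ω y)
  ¬abˢa^qbˢ s m = no-conjugate-halves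
    ((a ∷ []) ∷ bˢ ∷ replicate (suc (suc m + suc m)) a ∷ bˢ ∷ []) (a ∷ bˢ) aᵐ (cong (a ∷_) eq)
    (a≢b ∘ second {m})
    where
    bˢ = replicate (suc s) b
    aᵐ = replicate (suc m) a
    -- Both halves begin with `a`, so they are told apart by their second letters, `b` against `a`.
    -- The latter comes from `a ∷ bˢ` if `aᵐ` is a single letter, and from `aᵐ` itself otherwise.
    second : ∀ {m} → a ∷ bˢ ++ replicate (suc m) a ≡ replicate (suc m) a ++ a ∷ bˢ → a ≡ b
    second {zero} = sym ∘ ∷-injectiveˡ ∘ ∷-injectiveʳ
    second {suc _} = sym ∘ ∷-injectiveˡ ∘ ∷-injectiveʳ
    eq : bˢ ++ replicate (suc (suc m + suc m)) a ++ bˢ ++ [] ≡ (bˢ ++ aᵐ) ++ aᵐ ++ a ∷ bˢ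
    eq = begin
      bˢ ++ replicate (suc (suc m + suc m)) a ++ bˢ ++ []
        ≡⟨ cong (λ w → bˢ ++ replicate (suc (suc m + suc m)) a ++ w) (++-identityʳ bˢ) ⟩
      bˢ ++ replicate (suc (suc m + suc m)) a ++ bˢ
        -- The odd run is split as aᵐ · a · aᵐ, and the extra letter is then moved to the right end,
        -- where it becomes the head of `a ∷ bˢ`.
        ≡⟨ cong (λ k → bˢ ++ replicate k a ++ bˢ) (+-suc (suc m) (suc m)) ⟨
      bˢ ++ replicate (suc m + suc (suc m)) a ++ bˢ
        ≡⟨ cong (λ w → bˢ ++ w ++ bˢ) (replicate-+ (suc m) (suc (suc m)) a) ⟩
      bˢ ++ (aᵐ ++ a ∷ aᵐ) ++ bˢ
        ≡⟨ cong (λ w → bˢ ++ (aᵐ ++ w) ++ bˢ) (shift (suc m)) ⟩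
      bˢ ++ (aᵐ ++ aᵐ ++ a ∷ []) ++ bˢ
        ≡⟨ cong (bˢ ++_) (++-assoc aᵐ _ bˢ) ⟩
      bˢ ++ aᵐ ++ (aᵐ ++ a ∷ []) ++ bˢ
        ≡⟨ cong (λ w → bˢ ++ aᵐ ++ w) (++-assoc aᵐ _ bˢ) ⟩
      bˢ ++ aᵐ ++ aᵐ ++ a ∷ bˢ
        ≡⟨ ++-assoc bˢ aᵐ _ ⟨
      (bˢ ++ aᵐ) ++ aᵐ ++ a ∷ bˢ ∎
      where
      shift : ∀ k → a ∷ replicate k a ≡ replicate k a ++ a ∷ []
      shift zero = refl
      shift (suc k) = cong (a ∷_) (shift k)

  -- The halves are bba = b · ba and bab = ba · b.
  ¬bbabab : ¬ MesosomeFree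
    ((b ∷ b ∷ []) ++ω (a ∷ []) ++ω (b ∷ []) ++ω (a ∷ []) ++ω (b ∷ []) ++ω y)
  ¬bbabab = no-conjugate-halves
    ((b ∷ b ∷ []) ∷ (a ∷ []) ∷ (b ∷ []) ∷ (a ∷ []) ∷ (b ∷ []) ∷ []) (b ∷ []) (b ∷ a ∷ []) refl
    (a≢b ∘ sym ∘ ∷-injectiveˡ ∘ ∷-injectiveʳ)

  -- The halves are bab = b · ab and abb = ab · b. The last letter is a block of its own because
  -- `alternating` tests it against a known five-letter prefix.
  ¬bababb : ¬ MesosomeFree ((b ∷ a ∷ b ∷ a ∷ b ∷ []) ++ω (b ∷ []) ++ω y)
  ¬bababb = no-conjugate-halves ((b ∷ a ∷ b ∷ a ∷ b ∷ []) ∷ (b ∷ []) ∷ []) (b ∷ []) (a ∷ b ∷ []) refl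
    (a≢b ∘ sym ∘ ∷-injectiveˡ)

-- Decomposition into runs.

uncons : ∀ (y : ωWord A) → y 0 ≡ a → y ≗ (a ∷ []) ++ω (y ∘ suc)
uncons y refl zero = refl
uncons y refl (suc n) = refl

replicate-++ω-last : ∀ n (a : A) (y : ωWord A) → (replicate (suc n) a ++ω y) n ≡ a
replicate-++ω-last zero a y = refl
replicate-++ω-last (suc n) a y = replicate-++ω-last n a y

-- Used to refine a decomposition: the blocks `us` are already known, and the tail behind them is
-- resolved further.
MesosomeFree-tail : ∀ (us : List (Word A)) → x ≗ y →
  MesosomeFree (foldr _++ω_ x us) → MesosomeFree (foldr _++ω_ y us)
MesosomeFree-tail us x≗y = MesosomeFree-resp-≗ (foldr-cong us)
  where
  foldr-cong : ∀ us → foldr _++ω_ _ us ≗ foldr _++ω_ _ us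
  foldr-cong [] = x≗y
  foldr-cong (u ∷ us) = ++ω-cong u (foldr-cong us)

parity : ∀ n → ∃ λ m → n ≡ m + m ⊎ n ≡ suc (m + m)
parity zero = 0 , inj₁ refl
parity (suc n) with parity n
... | m , inj₁ refl = m , inj₂ refl
... | m , inj₂ refl = suc m , inj₁ (cong suc (sym (+-suc m m)))

inner-run-odd : ∀ n → a ≢ b → y 0 ≡ b →
  MesosomeFree ((b ∷ []) ++ω replicate (suc n) a ++ω y) → ∃ λ m → n ≡ m + m
inner-run-odd {a = a} {b = b} {y = y} n a≢b y₀≡b free with parity n
... | m , inj₁ even = m , even
-- The run now has length 2m + 2, a positive even number.
... | m , inj₂ refl = ⊥-elim (¬ba²ᵐb a≢b m
  (subst (λ k → MesosomeFree ((b ∷ []) ++ω replicate (suc k) a ++ω (b ∷ []) ++ω (y ∘ suc))) (sym (+-suc m m))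
    (MesosomeFree-tail ((b ∷ []) ∷ replicate (suc (suc (m + m))) a ∷ []) (uncons y y₀≡b) free)))

-- Only the first `n` letters are inspected, so deciding equality of bits suffices; the run itself
-- may be infinite.
bounded-run : ∀ n (b : Bit) (x : ωWord Bit) →
  (∃ λ y → x ≗ replicate n b ++ω y) ⊎
  (∃₂ λ m y → m < n × y 0 ≡ not b × x ≗ replicate m b ++ω y)
bounded-run zero b x = inj₁ (x , λ _ → refl)
bounded-run (suc n) b x with x 0 ≟ b
... | no x₀≢b = inj₂ (0 , x , s≤s z≤n , ¬-not x₀≢b , λ _ → refl)
... | yes x₀≡b with bounded-run n b (x ∘ suc)
... | inj₁ (y , eq) = inj₁ (y , λ { zero → x₀≡b ; (suc k) → eq k })
... | inj₂ (m , y , m<n , y₀ , eq) =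
  inj₂ (suc m , y , s≤s m<n , y₀ , λ { zero → x₀≡b ; (suc k) → eq k })

-- Excluded middle decides whether the first run ever ends. If it does, a letter other than `b` at
-- position `n` bounds the search by `suc n`.
run : ExcludedMiddle 0ℓ → ∀ (b : Bit) x → x 0 ≡ b →
  x ≗ [ b ] ^ω ⊎ ∃₂ λ n y → y 0 ≡ not b × x ≗ replicate (suc n) b ++ω y
run em b x x₀≡b with em {∃ λ n → x n ≢ b}
... | no none = inj₁ λ n → trans (x≡b n) (sym (^ω-const b n))
  where
  x≡b : ∀ n → x n ≡ b
  x≡b n with x n ≟ b
  ... | yes eq = eq
  ... | no neq = ⊥-elim (none (n , neq))
... | yes (n , xₙ≢b) with bounded-run (suc n) b x
... | inj₁ (y , eq) = ⊥-elim (xₙ≢b (trans (eq n) (replicate-++ω-last n b y)))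
... | inj₂ (suc m , y , _ , y₀ , eq) = inj₂ (m , y , y₀ , eq)
... | inj₂ (zero , y , _ , y₀ , eq) = ⊥-elim (not-¬ x₀≡b (trans (eq 0) y₀))

-- A window babab cannot be followed by b, so it is followed by a. Dropping its first letter gives
-- the window ababa, and the induction on the position continues with `a` and `b` exchanged.
alternating : ∀ {a b : Bit} → a ≢ b → ∀ {y} →
  MesosomeFree ((b ∷ a ∷ b ∷ a ∷ b ∷ []) ++ω y) →
  (b ∷ a ∷ b ∷ a ∷ b ∷ []) ++ω y ≗ (b ∷ a ∷ []) ^ω
alternating a≢b free zero = refl
alternating {a} {b} a≢b {y} free (suc n) with y 0 ≟ b
... | yes y₀≡b = ⊥-elim (¬bababb a≢b
  (MesosomeFree-tail ((b ∷ a ∷ b ∷ a ∷ b ∷ []) ∷ []) (uncons y y₀≡b) free))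
... | no y₀≢b = trans (shift n)
  (trans (alternating (a≢b ∘ sym) (MesosomeFree-resp-≗ shift (MesosomeFree-suc ((b ∷ a ∷ b ∷ a ∷ b ∷ []) ++ω y) free)) n)
    (sym ([ab]^ω-suc b a n)))
  where
  y₀≡a : y 0 ≡ a
  y₀≡a = trans (¬-not y₀≢b) (sym (¬-not a≢b))
  shift : (a ∷ b ∷ a ∷ b ∷ []) ++ω y ≗ (a ∷ b ∷ a ∷ b ∷ a ∷ []) ++ω (y ∘ suc)
  shift n = trans (++ω-cong (a ∷ b ∷ a ∷ b ∷ []) (uncons y y₀≡a) n)
    (sym (++ω-assoc (a ∷ b ∷ a ∷ b ∷ []) (a ∷ []) (y ∘ suc) n))

-- By ¬bˢa^qbˢa the third run is longer than the first, hence of length ≥ 3; then, with the roles of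
-- a and b exchanged, the run after it can be neither shorter than a^q nor at least as long.
¬bᵖa^qbˢa : ∀ {a b : Bit} → a ≡ not b → ∀ p m n {y} → y 0 ≡ a →
  ¬ MesosomeFree (replicate (suc p) b ++ω replicate (suc (suc m + suc m)) a ++ω
    replicate (suc (n + n)) b ++ω y)
¬bᵖa^qbˢa {a} {b} refl p m n {y} y₀ free with suc (n + n) ≤? suc p
... | yes s≤p = ¬bˢa^qbˢa (not-¬ refl ∘ sym) (n + n) m
  (MesosomeFree-tail (bˢ ∷ a^q ∷ bˢ ∷ []) (uncons y y₀) (MesosomeFree-shorten s≤p free))
  where
  bˢ = replicate (suc (n + n)) b
  a^q = replicate (suc (suc m + suc m)) a
... | no s≰p with n
... | zero = s≰p (s≤s z≤n)
-- The third run now has length at least 3, and the fourth is measured against the second, of length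
-- q.
... | suc n with bounded-run (suc (suc m + suc m)) a y
...   | inj₁ (z , eq) = ¬abˢa^qbˢ (not-¬ refl) (suc m + suc m) n
  (MesosomeFree-tail ((b ∷ []) ∷ a^q ∷ bˢ ∷ []) eq (MesosomeFree-shorten {m = 1} (s≤s z≤n) free))
  where
  bˢ = replicate (suc (suc n + suc n)) b
  a^q = replicate (suc (suc m + suc m)) a
-- The fourth run is not empty, since it begins with `y 0`, which is `a`.
...   | inj₂ (zero , z , _ , z₀ , eq) = not-¬ y₀ (trans (eq 0) z₀)
...   | inj₂ (suc t , z , t<q , z₀ , eq) = ¬bˢa^qbˢa (not-¬ refl) t n
  (MesosomeFree-shorten (<⇒≤ t<q)
    (MesosomeFree-tail (a^q ∷ bˢ ∷ aᵗ ∷ []) (uncons z (trans z₀ (not-involutive b)))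
      (MesosomeFree-tail (a^q ∷ bˢ ∷ []) eq (MesosomeFree-++ω⁻ (replicate (suc p) b) _ free))))
  where
  bˢ = replicate (suc (suc n + suc n)) b
  aᵗ = replicate (suc t) a
  a^q = replicate (suc (suc m + suc m)) a

-- Case analysis of words that begin with 0.

starts-with-0ᵖ101ᵗ0 : ∀ p n {x y} → MesosomeFree x → y 0 ≡ 𝟎 →
  x ≗ replicate (suc p) 𝟎 ++ω (𝟏 ∷ []) ++ω (𝟎 ∷ []) ++ω replicate (suc (n + n)) 𝟏 ++ω y → HasForm x
-- For t ≥ 3 the factor 1 0 1^t 0 is a b^s a^q b^s with s = 1.
starts-with-0ᵖ101ᵗ0 p (suc n) {y = y} free y₀ x≗ = ⊥-elim (¬abˢa^qbˢ (λ ()) 0 n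
  (MesosomeFree-tail ((𝟏 ∷ []) ∷ (𝟎 ∷ []) ∷ replicate (suc (suc n + suc n)) 𝟏 ∷ []) (uncons y y₀)
    (MesosomeFree-++ω⁻ (replicate (suc p) 𝟎) _ (MesosomeFree-resp-≗ x≗ free))))
-- For t = 1 and at least two leading zeros, 001010 occurs.
starts-with-0ᵖ101ᵗ0 (suc p) zero {y = y} free y₀ x≗ = ⊥-elim (¬bbabab (λ ())
  (MesosomeFree-shorten {m = 2} {n = suc (suc p)} (s≤s (s≤s z≤n))
    (MesosomeFree-tail (replicate (suc (suc p)) 𝟎 ∷ (𝟏 ∷ []) ∷ (𝟎 ∷ []) ∷ (𝟏 ∷ []) ∷ []) (uncons y y₀)
      (MesosomeFree-resp-≗ x≗ free))))
-- All four runs are single letters, and with the next 0 they form the window 01010.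
starts-with-0ᵖ101ᵗ0 zero zero {x} {y} free y₀ x≗ =
  [01]^ω λ k → trans (x≗01010 k) (alternating (λ ()) (MesosomeFree-resp-≗ x≗01010 free) k)
  where
  x≗01010 : x ≗ (𝟎 ∷ 𝟏 ∷ 𝟎 ∷ 𝟏 ∷ 𝟎 ∷ []) ++ω (y ∘ suc)
  x≗01010 k = trans (x≗ k)
    (trans (concat-++ω ((𝟎 ∷ []) ∷ (𝟏 ∷ []) ∷ (𝟎 ∷ []) ∷ (𝟏 ∷ []) ∷ []) y k)
      (trans (++ω-cong (𝟎 ∷ 𝟏 ∷ 𝟎 ∷ 𝟏 ∷ []) (uncons y y₀) k)
        (sym (++ω-assoc (𝟎 ∷ 𝟏 ∷ 𝟎 ∷ 𝟏 ∷ []) (𝟎 ∷ []) (y ∘ suc) k))))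

starts-with-0ᵖ101 : ExcludedMiddle 0ℓ → ∀ p {x y} → MesosomeFree x → y 0 ≡ 𝟏 →
  x ≗ replicate (suc p) 𝟎 ++ω (𝟏 ∷ []) ++ω (𝟎 ∷ []) ++ω y → HasForm x
starts-with-0ᵖ101 em p {x} {y} free y₀ x≗ with run em 𝟏 y y₀
... | inj₁ y≗1^ω = 0^i·10·1^ω (suc p) (s≤s z≤n) λ k → trans (x≗ k)
  (++ω-cong (replicate (suc p) 𝟎) (λ l → trans (sym (++ω-assoc (𝟏 ∷ []) (𝟎 ∷ []) y l))
    (++ω-cong (𝟏 ∷ 𝟎 ∷ []) y≗1^ω l)) k)
... | inj₂ (t , z , z₀ , y≗1ᵗz)
  with inner-run-odd t (λ ()) z₀ (MesosomeFree-++ω⁻ (𝟏 ∷ []) _ (MesosomeFree-++ω⁻ (replicate (suc p) 𝟎) _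
         (MesosomeFree-tail (replicate (suc p) 𝟎 ∷ (𝟏 ∷ []) ∷ (𝟎 ∷ []) ∷ []) y≗1ᵗz
           (MesosomeFree-resp-≗ x≗ free))))
... | n , refl = starts-with-0ᵖ101ᵗ0 p n free z₀ λ k → trans (x≗ k)
  (++ω-cong (replicate (suc p) 𝟎) (++ω-cong (𝟏 ∷ []) (++ω-cong (𝟎 ∷ []) y≗1ᵗz)) k)

-- Both inner runs must be single letters: q ≥ 3 is excluded by `¬bᵖa^qbˢa`, and for q = 1 a third
-- run with s ≥ 3 gives the mesosome 0 1 0^s 1.
starts-with-0ᵖ1^q0ˢ1 : ExcludedMiddle 0ℓ → ∀ p m n {x y} → MesosomeFree x → y 0 ≡ 𝟏 →
  x ≗ replicate (suc p) 𝟎 ++ω replicate (suc (m + m)) 𝟏 ++ω replicate (suc (n + n)) 𝟎 ++ω y → HasForm x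
starts-with-0ᵖ1^q0ˢ1 em p (suc m) n free y₀ x≗ =
  ⊥-elim (¬bᵖa^qbˢa refl p m n y₀ (MesosomeFree-resp-≗ x≗ free))
starts-with-0ᵖ1^q0ˢ1 em p zero (suc n) {y = y} free y₀ x≗ = ⊥-elim (¬abˢa^qbˢ (λ ()) 0 n
  (MesosomeFree-shorten {m = 1} {n = suc p} (s≤s z≤n)
    (MesosomeFree-tail (replicate (suc p) 𝟎 ∷ (𝟏 ∷ []) ∷ replicate (suc (suc n + suc n)) 𝟎 ∷ []) (uncons y y₀)
      (MesosomeFree-resp-≗ x≗ free))))
starts-with-0ᵖ1^q0ˢ1 em p zero zero free y₀ x≗ = starts-with-0ᵖ101 em p free y₀ x≗

2*suc∸1 : ∀ m → 2 * suc m ∸ 1 ≡ suc (m + m)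
2*suc∸1 m = trans (+-suc m (m + 0)) (cong (λ k → suc (m + k)) (+-identityʳ m))

starts-with-0ᵖ1^q0 : ExcludedMiddle 0ℓ → ∀ p q {x y} → MesosomeFree x → y 0 ≡ 𝟎 →
  x ≗ replicate (suc p) 𝟎 ++ω replicate (suc q) 𝟏 ++ω y → HasForm x
starts-with-0ᵖ1^q0 em p q {x} {y} free y₀ x≗
  with inner-run-odd q (λ ()) y₀
         (MesosomeFree-shorten {m = 1} {n = suc p} (s≤s z≤n) (MesosomeFree-resp-≗ x≗ free))
     | run em 𝟎 y y₀
-- The inner run has length 2m + 1 = 2j - 1 with j = m + 1.
... | m , refl | inj₁ y≗0^ω = 0^i·1^[2j-1]·0^ω (suc p) (suc m) (s≤s z≤n) (s≤s z≤n)
  (subst (λ k → x ≗ replicate (suc p) 𝟎 ++ω replicate k 𝟏 ++ω [ 𝟎 ] ^ω) (sym (2*suc∸1 m))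
    λ k → trans (x≗ k) (++ω-cong (replicate (suc p) 𝟎) (++ω-cong (replicate (suc (m + m)) 𝟏) y≗0^ω) k))
... | m , refl | inj₂ (s , z , z₀ , y≗0ˢz)
  with inner-run-odd s (λ ()) z₀ (MesosomeFree-shorten {m = 1} {n = suc (m + m)} (s≤s z≤n)
         (MesosomeFree-++ω⁻ (replicate (suc p) 𝟎) _
           (MesosomeFree-tail (replicate (suc p) 𝟎 ∷ replicate (suc (m + m)) 𝟏 ∷ []) y≗0ˢz
             (MesosomeFree-resp-≗ x≗ free))))
... | n , refl = starts-with-0ᵖ1^q0ˢ1 em p m n free z₀
  λ k → trans (x≗ k) (++ω-cong (replicate (suc p) 𝟎) (++ω-cong (replicate (suc (m + m)) 𝟏) y≗0ˢz) k)

starts-with-0 : ExcludedMiddle 0ℓ → ∀ x → MesosomeFree x → x 0 ≡ 𝟎 → HasForm x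
starts-with-0 em x free x₀ with run em 𝟎 x x₀
... | inj₁ x≗0^ω = 0^ω x≗0^ω
... | inj₂ (p , y , y₀ , x≗0ᵖy) with run em 𝟏 y y₀
...   | inj₁ y≗1^ω = 0^i·1^ω (suc p) (s≤s z≤n)
  λ k → trans (x≗0ᵖy k) (++ω-cong (replicate (suc p) 𝟎) y≗1^ω k)
...   | inj₂ (q , z , z₀ , y≗1^qz) = starts-with-0ᵖ1^q0 em p q free z₀
  λ k → trans (x≗0ᵖy k) (++ω-cong (replicate (suc p) 𝟎) y≗1^qz k)

theorem3 : ExcludedMiddle 0ℓ → (x : ωWord Bit) → MesosomeFree x → HasForm x ⊎ HasForm (complement x)
theorem3 em x free with x 0 in x₀
... | 𝟎 = inj₁ (starts-with-0 em x free x₀)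
... | 𝟏 = inj₂ (starts-with-0 em (complement x) (MesosomeFree-complement x free) (cong not x₀))
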